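{- For every integer $n\ge 0$, $\overline{p}_3(8n+7)\equiv 0 \pmod{64}$.
   Context: An overpartition of $n$ is a partition of $n$ in which the first occurrence of each distinct part may (or may not) be overlined. An overpartition triple of $n$ is a triple of overpartitions whose parts together sum to $n$. $\overline{p}_3(n)$ denotes the number of overpartition triples of $n$, with $\overline{p}_3(0)=1$; equivalently $\sum_{n\ge0}\overline{p}_3(n)q^n=\big((-q;q)_\infty/(q;q)_\infty\big)^3$, where $(a;q)_\infty=\prod_{n\ge0}(1-aq^n)$. -}

module Defs where

open import Data.Nat using (ℕ; zero; suc; _+_; _*_; _∸_; _<ᵇ_)
open import Data.Bool using (if_then_else_)

-- Power series with natural-number coefficients, represented as
-- coefficient functions  ℕ → ℕ  (coefficient of q^m).
Series : Set
Series = ℕ → ℕ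

mul1+ : ℕ → Series → Series
mul1+ k c m = if m <ᵇ k then c m else c m + c (m ∸ k)

-- multiplication by 1/(1 - q^k) = Σ_{j≥0} q^{jk}, k ≥ 1:
-- d(m) = Σ_{j ≥ 0, jk ≤ m} c(m - jk).  The sum is computed with fuel m+1
-- (enough since k ≥ 1).
geomSum : ℕ → ℕ → Series → ℕ → ℕ
geomSum zero    k c m = 0
geomSum (suc f) k c m = if m <ᵇ k then c m else c m + geomSum f k c (m ∸ k)

div1- : ℕ → Series → Series
div1- k c m = geomSum (suc m) k c m

factor3 : ℕ → Series → Series
factor3 k c = div1- k (div1- k (div1- k (mul1+ k (mul1+ k (mul1+ k c)))))

partialProd : ℕ → Series
partialProd zero    m = if m <ᵇ 1 then 1 else 0
partialProd (suc N) = factor3 (suc N) (partialProd N)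

-- p̄₃(n): coefficient of q^n in ((-q;q)_∞/(q;q)_∞)^3 = ∏_{k≥1} ((1+q^k)/(1-q^k))^3.
-- Factors with k > n do not affect the coefficient of q^n, so truncating
-- the product at N = n gives the exact value.
pbar3 : ℕ → ℕ
pbar3 n = partialProd n n

{-# OPTIONS --safe #-}
module Submission where

-- By Gauss, (x;x)/(−x;x) = 1 + 2s with s = Σ_{n≥1} (−1)ⁿ x^{n²}, so the generating function is
-- (1 + 2s)⁻³, which modulo 64 is 1 − 6s + 24s² − 80s³ + 240s⁴ − 672s⁵.  Split s = a + d into the
-- odd n, with exponents ≡ 1 (mod 8), and the even n, with exponents ≡ 0 (mod 4).  Among the
-- monomials aⁱdʲ with i + j ≤ 5 only a³dʲ has exponents ≡ 3 (mod 4); a³ itself has exponents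
-- ≡ 3 (mod 8), and the binomial coefficients make those of a³d and a³d² equal to 4 · 240 and
-- −10 · 672, both divisible by 64.
--
-- Gauss's identity is obtained from its finite form
--   (x;x)ₙ + Σ_{r=1}^{n} 2 (−1)ʳ x^{r(n+1)} (−x;x)_{r−1} (x^{r+1};x)_{n−r}
--     = (−x;x)ₙ (1 + 2 Σ_{r=1}^{n} (−1)ʳ x^{r²}),
-- proved by telescoping from n to n + 1; modulo x^{n+1} only (x;x)ₙ survives on the left.

open import Defs
open import Data.Nat using (ℕ; _+_; _*_)
open import Data.Nat.Divisibility using (_∣_)
open import Data.Nat using (zero; suc; _∸_; _<_; _<ᵇ_; _%_; z≤n; s≤s)
import Data.Nat.Properties as ℕ
open import Data.Nat.DivMod using ([m+kn]%n≡m%n)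
import Data.Nat.Tactic.RingSolver as ℕ-Solver
open import Data.Integer as ℤ using (ℤ; +_; -[1+_]; 0ℤ; 1ℤ)
import Data.Integer.Properties as ℤ
import Data.Integer.Tactic.RingSolver as ℤ-Solver
open import Data.Integer.Divisibility.Signed using (divides; ∣⇒∣ᵤ)
open import Data.Bool using (true; false; if_then_else_)
open import Data.Product using (∃; ∃₂; _×_; _,_)
open import Data.Sum using (_⊎_; inj₁; inj₂)
open import Data.List using (List; []; _∷_)
import Data.Maybe as Maybe
open import Function using (_∘_)
open import Level using (0ℓ)
open import Relation.Nullary using (contradiction)
open import Relation.Nullary.Decidable using (dec⇒maybe)
open import Relation.Binary using (IsEquivalence)
open import Relation.Binary.PropositionalEquality as ≡ using (_≡_; _≢_; cong; cong₂)
open import Algebra using (CommutativeRing)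
open import Algebra.Solver.Ring.AlmostCommutativeRing
  using (fromCommutativeRing; _-Raw-AlmostCommutative⟶_)
import Algebra.Solver.Ring as RingSolver

-- The ring ℤ⟦x⟧

ℤ⟦x⟧ : Set
ℤ⟦x⟧ = ℕ → ℤ

infix  4 _≈_
infixl 6 _⊕_
infixl 7 _⊗_ _·_
infix  8 ⊝_

-- Wrapping pointwise equality in a record lets Agda infer the two series.
record _≈_ (f g : ℤ⟦x⟧) : Set where
  constructor pointwise
  field at : ∀ n → f n ≡ g n
open _≈_

_⊕_ _⊗_ : ℤ⟦x⟧ → ℤ⟦x⟧ → ℤ⟦x⟧
⊝_ tail shift : ℤ⟦x⟧ → ℤ⟦x⟧
_·_ : ℤ → ℤ⟦x⟧ → ℤ⟦x⟧
const : ℤ → ℤ⟦x⟧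

(f ⊕ g) n = f n ℤ.+ g n
(⊝ f) n = ℤ.- f n
(c · f) n = c ℤ.* f n
tail f n = f (suc n)
shift f zero = 0ℤ
shift f (suc n) = f n
const c zero = c
const c (suc n) = 0ℤ

-- The Cauchy product read off from f = f(0) + x · `tail f`, so that the ring laws follow by
-- structural induction on the index, with no finite sums.
(f ⊗ g) zero = f 0 ℤ.* g 0
(f ⊗ g) (suc n) = f 0 ℤ.* g (suc n) ℤ.+ (tail f ⊗ g) n

≈-isEquivalence : IsEquivalence _≈_
≈-isEquivalence = record
  { refl  = pointwise λ _ → ≡.refl
  ; sym   = λ p → pointwise λ n → ≡.sym (at p n)
  ; trans = λ p q → pointwise λ n → ≡.trans (at p n) (at q n)
  }

⊗-cong : ∀ {f f′ g g′} → f ≈ f′ → g ≈ g′ → f ⊗ g ≈ f′ ⊗ g′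
⊗-cong p q = pointwise (go p q)
  where
  go : ∀ {f f′ g g′} → f ≈ f′ → g ≈ g′ → ∀ n → (f ⊗ g) n ≡ (f′ ⊗ g′) n
  go p q zero    = cong₂ ℤ._*_ (at p 0) (at q 0)
  go p q (suc n) = cong₂ ℤ._+_ (cong₂ ℤ._*_ (at p 0) (at q (suc n)))
                     (go (pointwise (at p ∘ suc)) q n)

⊗-distribʳ : ∀ h f g n → ((f ⊕ g) ⊗ h) n ≡ (f ⊗ h) n ℤ.+ (g ⊗ h) n
⊗-distribʳ h f g zero    = ℤ.*-distribʳ-+ (h 0) (f 0) (g 0)
⊗-distribʳ h f g (suc n) = ≡.trans
  (cong (ℤ._+_ ((f 0 ℤ.+ g 0) ℤ.* h (suc n))) (⊗-distribʳ h (tail f) (tail g) n))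
  (lemma (f 0) (g 0) (h (suc n)) ((tail f ⊗ h) n) ((tail g ⊗ h) n))
  where
  lemma : ∀ a b c u v → (a ℤ.+ b) ℤ.* c ℤ.+ (u ℤ.+ v) ≡ (a ℤ.* c ℤ.+ u) ℤ.+ (b ℤ.* c ℤ.+ v)
  lemma = ℤ-Solver.solve-∀

·-⊗-assoc : ∀ c f g n → ((c · f) ⊗ g) n ≡ c ℤ.* (f ⊗ g) n
·-⊗-assoc c f g zero    = ℤ.*-assoc c (f 0) (g 0)
·-⊗-assoc c f g (suc n) = ≡.trans
  (cong (ℤ._+_ ((c ℤ.* f 0) ℤ.* g (suc n))) (·-⊗-assoc c (tail f) g n))
  (lemma c (f 0) (g (suc n)) ((tail f ⊗ g) n))
  where
  lemma : ∀ c a b u → (c ℤ.* a) ℤ.* b ℤ.+ c ℤ.* u ≡ c ℤ.* (a ℤ.* b ℤ.+ u)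
  lemma = ℤ-Solver.solve-∀

-- The mirror image of the defining recursion: here the right factor is split as g(0) + x ·
-- `tail g`. Commutativity compares the two.
⊗-sucʳ : ∀ f g n → (f ⊗ g) (suc n) ≡ (f ⊗ tail g) n ℤ.+ f (suc n) ℤ.* g 0
⊗-sucʳ f g zero    = ≡.refl
⊗-sucʳ f g (suc n) = ≡.trans
  (cong (ℤ._+_ (f 0 ℤ.* g (suc (suc n)))) (⊗-sucʳ (tail f) g n))
  (≡.sym (ℤ.+-assoc (f 0 ℤ.* g (suc (suc n))) ((tail f ⊗ tail g) n) (f (suc (suc n)) ℤ.* g 0)))

⊗-comm : ∀ f g n → (f ⊗ g) n ≡ (g ⊗ f) n
⊗-comm f g zero    = ℤ.*-comm (f 0) (g 0)
⊗-comm f g (suc n) = begin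
  f 0 ℤ.* g (suc n) ℤ.+ (tail f ⊗ g) n ≡⟨ ℤ.+-comm (f 0 ℤ.* g (suc n)) _ ⟩
  (tail f ⊗ g) n ℤ.+ f 0 ℤ.* g (suc n) ≡⟨ cong₂ ℤ._+_ (⊗-comm (tail f) g n) (ℤ.*-comm (f 0) (g (suc n))) ⟩
  (g ⊗ tail f) n ℤ.+ g (suc n) ℤ.* f 0 ≡⟨ ⊗-sucʳ g f n ⟨
  (g ⊗ f) (suc n) ∎
  where open ≡.≡-Reasoning

⊗-assoc : ∀ f g h n → ((f ⊗ g) ⊗ h) n ≡ (f ⊗ (g ⊗ h)) n
⊗-assoc f g h zero    = ℤ.*-assoc (f 0) (g 0) (h 0)
⊗-assoc f g h (suc n) = begin
  (f 0 ℤ.* g 0) ℤ.* h (suc n) ℤ.+ ((f 0 · tail g ⊕ tail f ⊗ g) ⊗ h) n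
    ≡⟨ cong (ℤ._+_ ((f 0 ℤ.* g 0) ℤ.* h (suc n))) (⊗-distribʳ h (f 0 · tail g) (tail f ⊗ g) n) ⟩
  (f 0 ℤ.* g 0) ℤ.* h (suc n) ℤ.+ (((f 0 · tail g) ⊗ h) n ℤ.+ ((tail f ⊗ g) ⊗ h) n)
    ≡⟨ cong (ℤ._+_ ((f 0 ℤ.* g 0) ℤ.* h (suc n))) (cong₂ ℤ._+_ (·-⊗-assoc (f 0) (tail g) h n) (⊗-assoc (tail f) g h n)) ⟩
  (f 0 ℤ.* g 0) ℤ.* h (suc n) ℤ.+ (f 0 ℤ.* (tail g ⊗ h) n ℤ.+ (tail f ⊗ (g ⊗ h)) n)
    ≡⟨ lemma (f 0) (g 0) (h (suc n)) ((tail g ⊗ h) n) ((tail f ⊗ (g ⊗ h)) n) ⟩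
  f 0 ℤ.* (g 0 ℤ.* h (suc n) ℤ.+ (tail g ⊗ h) n) ℤ.+ (tail f ⊗ (g ⊗ h)) n ∎
  where
  open ≡.≡-Reasoning
  lemma : ∀ a b c u v → (a ℤ.* b) ℤ.* c ℤ.+ (a ℤ.* u ℤ.+ v) ≡ a ℤ.* (b ℤ.* c ℤ.+ u) ℤ.+ v
  lemma = ℤ-Solver.solve-∀

zero-⊗ : ∀ f n → ((λ _ → 0ℤ) ⊗ f) n ≡ 0ℤ
zero-⊗ f zero    = ℤ.*-zeroˡ (f 0)
zero-⊗ f (suc n) = cong₂ ℤ._+_ (ℤ.*-zeroˡ (f (suc n))) (zero-⊗ f n)

const-⊗ : ∀ c f n → (const c ⊗ f) n ≡ c ℤ.* f n
const-⊗ c f zero    = ≡.refl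
const-⊗ c f (suc n) = ≡.trans (cong (ℤ._+_ (c ℤ.* f (suc n))) (zero-⊗ f n)) (ℤ.+-identityʳ _)

ℤ⟦x⟧-commutativeRing : CommutativeRing 0ℓ 0ℓ
ℤ⟦x⟧-commutativeRing = record
  { Carrier = ℤ⟦x⟧ ; _≈_ = _≈_ ; _+_ = _⊕_ ; _*_ = _⊗_ ; -_ = ⊝_
  ; 0# = const 0ℤ ; 1# = const 1ℤ
  ; isCommutativeRing = record
    { isRing = record
      { +-isAbelianGroup = record
        { isGroup = record
          { isMonoid = record
            { isSemigroup = record
              { isMagma = record
                { isEquivalence = ≈-isEquivalence
                ; ∙-cong = λ p q → pointwise λ n → cong₂ ℤ._+_ (at p n) (at q n)
                }
              ; assoc = λ f g h → pointwise λ n → ℤ.+-assoc (f n) (g n) (h n)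
              }
            ; identity = (λ f → pointwise (zero-⊕ f))
                       , (λ f → pointwise λ n → ≡.trans (ℤ.+-comm (f n) _) (zero-⊕ f n))
            }
          ; inverse = (λ f → pointwise (⊝-inverse f))
                    , (λ f → pointwise λ n → ≡.trans (ℤ.+-comm (f n) _) (⊝-inverse f n))
          ; ⁻¹-cong = λ p → pointwise λ n → cong ℤ.-_ (at p n)
          }
        ; comm = λ f g → pointwise λ n → ℤ.+-comm (f n) (g n)
        }
      ; *-cong = ⊗-cong
      ; *-assoc = λ f g h → pointwise (⊗-assoc f g h)
      ; *-identity = (λ f → pointwise (one-⊗ f))
                   , (λ f → pointwise λ n → ≡.trans (⊗-comm f _ n) (one-⊗ f n))
      ; distrib = (λ h f g → pointwise λ n → ≡.trans (⊗-comm h (f ⊕ g) n)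
                    (≡.trans (⊗-distribʳ h f g n) (cong₂ ℤ._+_ (⊗-comm f h n) (⊗-comm g h n))))
                , (λ h f g → pointwise (⊗-distribʳ h f g))
      }
    ; *-comm = λ f g → pointwise (⊗-comm f g)
    }
  }
  where
  zero-⊕ : ∀ f n → (const 0ℤ ⊕ f) n ≡ f n
  zero-⊕ f zero    = ℤ.+-identityˡ (f 0)
  zero-⊕ f (suc n) = ℤ.+-identityˡ (f (suc n))
  ⊝-inverse : ∀ f n → (⊝ f ⊕ f) n ≡ const 0ℤ n
  ⊝-inverse f zero    = ℤ.+-inverseˡ (f 0)
  ⊝-inverse f (suc n) = ℤ.+-inverseˡ (f (suc n))
  one-⊗ : ∀ f n → (const 1ℤ ⊗ f) n ≡ f n
  one-⊗ f n = ≡.trans (const-⊗ 1ℤ f n) (ℤ.*-identityˡ (f n))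

open CommutativeRing ℤ⟦x⟧-commutativeRing
  using (setoid; refl; sym; trans; +-cong; +-congˡ; +-congʳ; *-congˡ; *-congʳ; *-identityˡ; -‿cong; reflexive)
open import Relation.Binary.Reasoning.Setoid setoid

-- Lets the ring solver compute with integer coefficients, whose equality is decidable, while series
-- stay opaque atoms.
const-morphism : ℤ.+-*-rawRing -Raw-AlmostCommutative⟶ fromCommutativeRing ℤ⟦x⟧-commutativeRing
const-morphism = record
  { ⟦_⟧    = const
  ; +-homo = λ a b → pointwise λ { zero → ≡.refl ; (suc n) → ≡.refl }
  ; *-homo = λ a b → pointwise λ n → ≡.sym (≡.trans (const-⊗ a (const b) n) (scaled a b n))
  ; -‿homo = λ a → pointwise λ { zero → ≡.refl ; (suc n) → ≡.refl }
  ; 0-homo = refl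
  ; 1-homo = refl
  }
  where
  scaled : ∀ a b n → a ℤ.* const b n ≡ const (a ℤ.* b) n
  scaled a b zero    = ≡.refl
  scaled a b (suc n) = ℤ.*-zeroʳ a

open RingSolver ℤ.+-*-rawRing (fromCommutativeRing ℤ⟦x⟧-commutativeRing) const-morphism
  (λ a b → Maybe.map (reflexive ∘ cong const) (dec⇒maybe (a ℤ.≟ b)))
  using (Polynomial; solve; con; _:+_; _:*_; :-_; _:=_)

-- Monomials and order of vanishing

infix 9 x^_

x^_ : ℕ → ℤ⟦x⟧
x^ zero  = const 1ℤ
x^ suc k = shift (x^ k)

shift-⊗ : ∀ f g → shift f ⊗ g ≈ shift (f ⊗ g)
shift-⊗ f g = pointwise λ
  { zero    → ℤ.*-zeroˡ (g 0)
  ; (suc n) → ≡.trans (cong (ℤ._+ (f ⊗ g) n) (ℤ.*-zeroˡ (g (suc n)))) (ℤ.+-identityˡ _) }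

shift-cong : ∀ {f g} → f ≈ g → shift f ≈ shift g
shift-cong p = pointwise λ { zero → ≡.refl ; (suc n) → at p n }

x^-cong : ∀ {j k} → j ≡ k → x^ j ≈ x^ k
x^-cong p = reflexive (cong x^_ p)

x^-+ : ∀ j k → x^ (j + k) ≈ x^ j ⊗ x^ k
x^-+ zero    k = sym (*-identityˡ (x^ k))
x^-+ (suc j) k = trans (shift-cong (x^-+ j k)) (sym (shift-⊗ (x^ j) (x^ k)))

-- The test on `n <ᵇ k` has the same shape as in `mul1+` and `geomSum`, which is how those turn into
-- products with `x^ k`.
x^-⊗ : ∀ k f n → (x^ k ⊗ f) n ≡ (if n <ᵇ k then 0ℤ else f (n ∸ k))
x^-⊗ zero    f n       = at (*-identityˡ f) n
x^-⊗ (suc k) f zero    = at (shift-⊗ (x^ k) f) zero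
x^-⊗ (suc k) f (suc n) = ≡.trans (at (shift-⊗ (x^ k) f) (suc n)) (x^-⊗ k f n)

VanishesBelow : ℕ → ℤ⟦x⟧ → Set
VanishesBelow n f = ∀ m → m < n → f m ≡ 0ℤ

vanishesBelow-x^ : ∀ n f → VanishesBelow n (x^ n ⊗ f)
vanishesBelow-x^ (suc n) f zero    _         = at (shift-⊗ (x^ n) f) zero
vanishesBelow-x^ (suc n) f (suc m) (s≤s m<n) =
  ≡.trans (at (shift-⊗ (x^ n) f) (suc m)) (vanishesBelow-x^ n f m m<n)

⊗-sucʳ-vanish : ∀ f g n → g 0 ≡ 0ℤ → (f ⊗ g) (suc n) ≡ (f ⊗ tail g) n
⊗-sucʳ-vanish f g n g0≡0 = ≡.trans (⊗-sucʳ f g n) (≡.trans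
  (cong (ℤ._+_ ((f ⊗ tail g) n)) (≡.trans (cong (f (suc n) ℤ.*_) g0≡0) (ℤ.*-zeroʳ (f (suc n)))))
  (ℤ.+-identityʳ _))

vanishesBelow-⊗ : ∀ n f {g} → VanishesBelow n g → VanishesBelow n (f ⊗ g)
vanishesBelow-⊗ (suc n) f {g} v zero    _ =
  ≡.trans (cong (f 0 ℤ.*_) (v 0 (s≤s z≤n))) (ℤ.*-zeroʳ (f 0))
vanishesBelow-⊗ (suc n) f {g} v (suc m) (s≤s m<n) = ≡.trans
  (⊗-sucʳ-vanish f g m (v 0 (s≤s z≤n)))
  (vanishesBelow-⊗ n f {tail g} (λ k k<n → v (suc k) (s≤s k<n)) m m<n)

-- Since f has constant term 1, the constant term of the product is that of g; once it is 0, divide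
-- g by x and repeat.
vanishesBelow-cancel : ∀ n f {g} → f 0 ≡ 1ℤ → VanishesBelow n (f ⊗ g) → VanishesBelow n g
vanishesBelow-cancel (suc n) f {g} f0≡1 v = go
  where
  g0≡0 : g 0 ≡ 0ℤ
  g0≡0 = ≡.trans (≡.sym (ℤ.*-identityˡ (g 0)))
    (≡.trans (cong (ℤ._* g 0) (≡.sym f0≡1)) (v 0 (s≤s z≤n)))
  go : VanishesBelow (suc n) g
  go zero    _         = g0≡0
  go (suc m) (s≤s m<n) = vanishesBelow-cancel n f {tail g} f0≡1
    (λ k k<n → ≡.trans (≡.sym (⊗-sucʳ-vanish f g k g0≡0)) (v (suc k) (s≤s k<n))) m m<n

-- Gauss's theta identity

sgn : ℕ → ℤ⟦x⟧
sgn zero    = const 1ℤ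
sgn (suc n) = ⊝ sgn n

1+x^_ 1-x^_ : ℕ → ℤ⟦x⟧
1+x^ k = const 1ℤ ⊕ x^ k
1-x^ k = const 1ℤ ⊕ ⊝ x^ k

-- (-x; x)ₙ
plusProd : ℕ → ℤ⟦x⟧
plusProd zero    = const 1ℤ
plusProd (suc n) = 1+x^ (suc n) ⊗ plusProd n

-- (x^{s+1}; x)ⱼ
minusProd : ℕ → ℕ → ℤ⟦x⟧
minusProd s zero    = const 1ℤ
minusProd s (suc j) = minusProd s j ⊗ 1-x^ (s + suc j)

minusProd-sucˡ : ∀ s j → minusProd s (suc j) ≈ 1-x^ (suc s) ⊗ minusProd (suc s) j
minusProd-sucˡ s zero    = begin
  const 1ℤ ⊗ 1-x^ (s + 1)   ≈⟨ *-congˡ (reflexive (cong 1-x^_ (ℕ.+-comm s 1))) ⟩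
  const 1ℤ ⊗ 1-x^ (suc s)   ≈⟨ solve 1 (λ y → con 1ℤ :* y := y :* con 1ℤ) refl (1-x^ (suc s)) ⟩
  1-x^ (suc s) ⊗ const 1ℤ   ∎
minusProd-sucˡ s (suc j) = begin
  minusProd s (suc j) ⊗ 1-x^ (s + suc (suc j))
    ≈⟨ ⊗-cong (minusProd-sucˡ s j) (reflexive (cong 1-x^_ (ℕ.+-suc s (suc j)))) ⟩
  1-x^ (suc s) ⊗ minusProd (suc s) j ⊗ 1-x^ (suc s + suc j)
    ≈⟨ solve 3 (λ a b c → a :* b :* c := a :* (b :* c)) refl
         (1-x^ (suc s)) (minusProd (suc s) j) (1-x^ (suc s + suc j)) ⟩
  1-x^ (suc s) ⊗ (minusProd (suc s) j ⊗ 1-x^ (suc s + suc j)) ∎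

-- With n = r + j, this is the factor 2 (-1)^{r+1} x^{(r+1)(n+1)} (-x;x)_r of the summand of index r
-- + 1 in the finite identity for n.
coeff : ℕ → ℕ → ℤ⟦x⟧
coeff r j = const (+ 2) ⊗ sgn (suc r) ⊗ x^ (suc r * (suc r + j)) ⊗ plusProd r

coeff-sucʳ : ∀ r j → coeff r (suc j) ≈ x^ (suc r) ⊗ coeff r j
coeff-sucʳ r j = begin
  const (+ 2) ⊗ sgn (suc r) ⊗ x^ (suc r * (suc r + suc j)) ⊗ plusProd r
    ≈⟨ *-congʳ (*-congˡ (trans (x^-cong (exponent r j)) (x^-+ (suc r) (suc r * (suc r + j))))) ⟩
  const (+ 2) ⊗ sgn (suc r) ⊗ (x^ (suc r) ⊗ x^ (suc r * (suc r + j))) ⊗ plusProd r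
    ≈⟨ solve 4 (λ e y z p → con (+ 2) :* e :* (y :* z) :* p := y :* (con (+ 2) :* e :* z :* p)) refl
         (sgn (suc r)) (x^ (suc r)) (x^ (suc r * (suc r + j))) (plusProd r) ⟩
  x^ (suc r) ⊗ coeff r j ∎
  where
  exponent : ∀ r j → suc r * (suc r + suc j) ≡ suc r + suc r * (suc r + j)
  exponent = ℕ-Solver.solve-∀

-- Both sides belong to the same n = r + 1 + j: this is the ratio of consecutive summands' factors,
-- whereas `coeff-sucʳ` raises n with the index fixed.
coeff-sucˡ : ∀ r j →
  coeff (suc r) j ≈ ⊝ (x^ (suc r + suc j) ⊗ 1+x^ (suc r) ⊗ coeff r (suc j))
coeff-sucˡ r j = begin
  const (+ 2) ⊗ (⊝ sgn (suc r)) ⊗ x^ (suc (suc r) * (suc (suc r) + j)) ⊗ (1+x^ (suc r) ⊗ plusProd r)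
    ≈⟨ *-congʳ (*-congˡ (trans (x^-cong (exponent r j)) (x^-+ (suc r + suc j) (suc r * (suc r + suc j))))) ⟩
  const (+ 2) ⊗ (⊝ sgn (suc r)) ⊗ (x^ (suc r + suc j) ⊗ x^ (suc r * (suc r + suc j))) ⊗ (1+x^ (suc r) ⊗ plusProd r)
    ≈⟨ solve 5 (λ e y z u p → con (+ 2) :* (:- e) :* (y :* z) :* (u :* p)
                           := :- (y :* u :* (con (+ 2) :* e :* z :* p))) refl
         (sgn (suc r)) (x^ (suc r + suc j)) (x^ (suc r * (suc r + suc j))) (1+x^ (suc r)) (plusProd r) ⟩
  ⊝ (x^ (suc r + suc j) ⊗ 1+x^ (suc r) ⊗ coeff r (suc j)) ∎
  where
  exponent : ∀ r j → suc (suc r) * (suc (suc r) + j) ≡ (suc r + suc j) + suc r * (suc r + suc j)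
  exponent = ℕ-Solver.solve-∀

-- partialSum r j is the left side of the finite identity for n = r + j, with the sum cut after its
-- r-th term; indexing by j = n − r avoids truncated subtraction.
partialSum : ℕ → ℕ → ℤ⟦x⟧
partialSum zero    j = minusProd 0 j
partialSum (suc r) j = partialSum r (suc j) ⊕ coeff r (suc j) ⊗ minusProd (suc r) j

-- The telescoping step. With n = r + j, passing to n + 1 multiplies the truncated sum by 1 +
-- x^{n+1}, up to the single boundary term `coeff r j ⊗ minusProd r j`.
partialSum-sucʳ : ∀ r j →
  partialSum r (suc j) ≈ 1+x^ (r + suc j) ⊗ partialSum r j ⊕ coeff r j ⊗ minusProd r j
partialSum-sucʳ zero j = begin
  minusProd 0 j ⊗ 1-x^ (suc j)
    ≈⟨ solve 2 (λ b y → b :* (con 1ℤ :+ :- y)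
         := (con 1ℤ :+ y) :* b :+ con (+ 2) :* (:- con 1ℤ) :* y :* con 1ℤ :* b) refl
         (minusProd 0 j) (x^ suc j) ⟩
  1+x^ (suc j) ⊗ minusProd 0 j ⊕ const (+ 2) ⊗ (⊝ const 1ℤ) ⊗ x^ (suc j) ⊗ const 1ℤ ⊗ minusProd 0 j
    ≈⟨ +-congˡ {1+x^ (suc j) ⊗ minusProd 0 j} (*-congʳ (*-congʳ (*-congˡ (x^-cong (≡.sym (ℕ.+-identityʳ (suc j))))))) ⟩
  1+x^ (suc j) ⊗ minusProd 0 j ⊕ coeff 0 j ⊗ minusProd 0 j ∎
partialSum-sucʳ (suc r) j = begin
  partialSum r (suc (suc j)) ⊕ coeff r (suc (suc j)) ⊗ (b ⊗ 1-x^ (suc r + suc j))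
    ≈⟨ +-cong (partialSum-sucʳ r (suc j)) (*-congʳ (coeff-sucʳ r (suc j))) ⟩
  1+x^ (r + suc (suc j)) ⊗ l ⊕ c ⊗ minusProd r (suc j) ⊕ x^ (suc r) ⊗ c ⊗ (b ⊗ 1-x^ (suc r + suc j))
    ≈⟨ +-congʳ {x^ (suc r) ⊗ c ⊗ (b ⊗ 1-x^ (suc r + suc j))} (+-cong (*-congʳ (reflexive (cong 1+x^_ (ℕ.+-suc r (suc j))))) (*-congˡ (minusProd-sucˡ r j))) ⟩
  1+x^ (suc r + suc j) ⊗ l ⊕ c ⊗ (1-x^ (suc r) ⊗ b) ⊕ x^ (suc r) ⊗ c ⊗ (b ⊗ 1-x^ (suc r + suc j))
    -- The old boundary term c(1 - y)b and the new summand yc · b(1 - z) add up to cb(1 - yz) = (1 +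
    -- z)cb - z(1 + y)cb; the last piece is the new boundary term.
    ≈⟨ solve 5 (λ l c b y z →
           (con 1ℤ :+ z) :* l :+ c :* ((con 1ℤ :+ :- y) :* b) :+ y :* c :* (b :* (con 1ℤ :+ :- z))
         := (con 1ℤ :+ z) :* (l :+ c :* b) :+ (:- (z :* (con 1ℤ :+ y) :* c)) :* b) refl
         l c b (x^ (suc r)) (x^ (suc r + suc j)) ⟩
  1+x^ (suc r + suc j) ⊗ (l ⊕ c ⊗ b) ⊕ (⊝ (x^ (suc r + suc j) ⊗ 1+x^ (suc r) ⊗ c)) ⊗ b
    ≈⟨ +-congˡ {1+x^ (suc r + suc j) ⊗ (l ⊕ c ⊗ b)} (*-congʳ (coeff-sucˡ r j)) ⟨
  1+x^ (suc r + suc j) ⊗ (l ⊕ c ⊗ b) ⊕ coeff (suc r) j ⊗ b ∎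
  where
  l = partialSum r (suc j)
  c = coeff r (suc j)
  b = minusProd (suc r) j

halfTheta : ℕ → ℤ⟦x⟧
halfTheta zero    = const 0ℤ
halfTheta (suc n) = halfTheta n ⊕ sgn (suc n) ⊗ x^ (suc n * suc n)

theta : ℤ⟦x⟧ → ℤ⟦x⟧
theta s = const 1ℤ ⊕ const (+ 2) ⊗ s

-- From n to n + 1 the boundary term c and the new last summand x^{n+1} c combine to (1 + x^{n+1})
-- c, and c is (-x;x)_n times twice the next term of `halfTheta`.
partialSum-theta : ∀ n → partialSum n 0 ≈ plusProd n ⊗ theta (halfTheta n)
partialSum-theta zero =
  solve 0 (con 1ℤ := con 1ℤ :* (con 1ℤ :+ con (+ 2) :* con 0ℤ)) refl
partialSum-theta (suc n) = begin
  partialSum n 1 ⊕ coeff n 1 ⊗ const 1ℤ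
    ≈⟨ +-cong (partialSum-sucʳ n 0) (*-congʳ (coeff-sucʳ n 0)) ⟩
  1+x^ (n + 1) ⊗ partialSum n 0 ⊕ coeff n 0 ⊗ const 1ℤ ⊕ x^ (suc n) ⊗ coeff n 0 ⊗ const 1ℤ
    ≈⟨ +-cong (+-cong (⊗-cong (reflexive (cong 1+x^_ (ℕ.+-comm n 1))) (partialSum-theta n)) (*-congʳ coeff₀))
              (*-congʳ (*-congˡ coeff₀)) ⟩
  1+x^ (suc n) ⊗ (p ⊗ theta s) ⊕ c ⊗ const 1ℤ ⊕ x^ (suc n) ⊗ c ⊗ const 1ℤ
    ≈⟨ solve 5 (λ p s e y z →
           (con 1ℤ :+ y) :* (p :* (con 1ℤ :+ con (+ 2) :* s))
             :+ (con (+ 2) :* e :* z :* p) :* con 1ℤ :+ y :* (con (+ 2) :* e :* z :* p) :* con 1ℤ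
         := ((con 1ℤ :+ y) :* p) :* (con 1ℤ :+ con (+ 2) :* (s :+ e :* z))) refl
         p s (sgn (suc n)) (x^ (suc n)) (x^ (suc n * suc n)) ⟩
  (1+x^ (suc n) ⊗ p) ⊗ theta (s ⊕ sgn (suc n) ⊗ x^ (suc n * suc n)) ∎
  where
  p = plusProd n
  s = halfTheta n
  c = const (+ 2) ⊗ sgn (suc n) ⊗ x^ (suc n * suc n) ⊗ p
  coeff₀ : coeff n 0 ≈ c
  coeff₀ = *-congʳ (*-congˡ (x^-cong (cong (suc n *_) (ℕ.+-identityʳ (suc n)))))

-- Every summand carries x^{r(n+1)} with r ≥ 1, hence a factor x^{n+1}; R collects the quotients.
-- The equation r + j = n keeps n fixed while the induction trades r for j.
partialSum-minusProd : ∀ r {j n} → r + j ≡ n →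
  ∃ λ R → partialSum r j ≈ minusProd 0 n ⊕ x^ (suc n) ⊗ R
partialSum-minusProd zero {j} ≡.refl = const 0ℤ ,
  solve 2 (λ b y → b := b :+ y :* con 0ℤ) refl (minusProd 0 j) (x^ suc j)
partialSum-minusProd (suc r) {j} ≡.refl
  with R , eq ← partialSum-minusProd r {suc j} (ℕ.+-suc r j) = R ⊕ E ⊗ const (+ 2) ⊗ Q , (begin
  partialSum r (suc j) ⊕ coeff r (suc j) ⊗ minusProd (suc r) j
    ≈⟨ +-cong eq (*-congʳ (*-congʳ (*-congˡ
         (trans (x^-+ (suc r + suc j) (r * (suc r + suc j)))
                (*-congʳ (x^-cong (cong suc (ℕ.+-suc r j)))))))) ⟩
  minusProd 0 n ⊕ x^ (suc n) ⊗ R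
    ⊕ const (+ 2) ⊗ sgn (suc r) ⊗ (x^ (suc n) ⊗ E) ⊗ plusProd r ⊗ minusProd (suc r) j
    ≈⟨ solve 7 (λ b y R e E p m →
           b :+ y :* R :+ con (+ 2) :* e :* (y :* E) :* p :* m
         := b :+ y :* (R :+ E :* con (+ 2) :* (e :* p :* m))) refl
         (minusProd 0 n) (x^ (suc n)) R (sgn (suc r)) E (plusProd r) (minusProd (suc r) j) ⟩
  minusProd 0 n ⊕ x^ (suc n) ⊗ (R ⊕ E ⊗ const (+ 2) ⊗ Q) ∎)
  where
  n = suc r + j
  E = x^ (r * (suc r + suc j))
  Q = sgn (suc r) ⊗ plusProd r ⊗ minusProd (suc r) j

-- The generating function of overpartition triples

fromSeries : Series → ℤ⟦x⟧
fromSeries c m = + c m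

fromSeries-mul1+ : ∀ k c → fromSeries (mul1+ k c) ≈ 1+x^ k ⊗ fromSeries c
fromSeries-mul1+ k c = trans
  (pointwise λ m → ≡.trans (cases m) (cong (ℤ._+_ (+ c m)) (≡.sym (x^-⊗ k (fromSeries c) m))))
  (solve 2 (λ c y → c :+ y :* c := (con 1ℤ :+ y) :* c) refl (fromSeries c) (x^ k))
  where
  cases : ∀ m → + mul1+ k c m ≡ + c m ℤ.+ (if m <ᵇ k then 0ℤ else + c (m ∸ k))
  cases m with m <ᵇ k
  ... | true  = ≡.sym (ℤ.+-identityʳ (+ c m))
  ... | false = ≡.refl

-- Each call lowers the exponent by at least 1, so any fuel above m suffices. Unfolding `div1-` once
-- leaves more fuel than `div1-` itself would supply at the smaller exponent.
geomSum-fuel : ∀ k c f f′ m → m < f → m < f′ → geomSum f (suc k) c m ≡ geomSum f′ (suc k) c m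
geomSum-fuel k c (suc f) (suc f′) m (s≤s m≤f) (s≤s m≤f′) with m <ᵇ suc k in eq
... | true  = ≡.refl
geomSum-fuel k c (suc f) (suc f′) (suc m) (s≤s m<f) (s≤s m<f′) | false =
  cong (_+_ (c (suc m))) (geomSum-fuel k c f f′ (m ∸ k)
    (ℕ.≤-<-trans (ℕ.m∸n≤m m k) m<f) (ℕ.≤-<-trans (ℕ.m∸n≤m m k) m<f′))

-- One unfolding of the geometric sum gives D = c + x^{k+1} D, and the last term is moved across.
fromSeries-div1- : ∀ k c → 1-x^ (suc k) ⊗ fromSeries (div1- (suc k) c) ≈ fromSeries c
fromSeries-div1- k c = begin
  1-x^ (suc k) ⊗ D
    ≈⟨ solve 2 (λ y d → (con 1ℤ :+ :- y) :* d := d :+ :- (y :* d)) refl (x^ suc k) D ⟩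
  D ⊕ ⊝ (x^ suc k ⊗ D)
    ≈⟨ +-congʳ {⊝ (x^ suc k ⊗ D)} unfold ⟩
  fromSeries c ⊕ x^ suc k ⊗ D ⊕ ⊝ (x^ suc k ⊗ D)
    ≈⟨ solve 2 (λ c z → c :+ z :+ :- z := c) refl (fromSeries c) (x^ suc k ⊗ D) ⟩
  fromSeries c ∎
  where
  D = fromSeries (div1- (suc k) c)
  cases : ∀ m → D m ≡ + c m ℤ.+ (if m <ᵇ suc k then 0ℤ else D (m ∸ suc k))
  cases m with m <ᵇ suc k in eq
  ... | true  = ≡.sym (ℤ.+-identityʳ (+ c m))
  cases (suc m) | false = cong (λ z → + (c (suc m) + z))
    (geomSum-fuel k c (suc m) (suc (m ∸ k)) (m ∸ k) (s≤s (ℕ.m∸n≤m m k)) ℕ.≤-refl)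
  unfold : D ≈ fromSeries c ⊕ x^ suc k ⊗ D
  unfold = pointwise λ m → ≡.trans (cases m) (cong (ℤ._+_ (+ c m)) (≡.sym (x^-⊗ (suc k) D m)))

cube : ℤ⟦x⟧ → ℤ⟦x⟧
cube f = f ⊗ f ⊗ f

fromSeries-factor3 : ∀ k c →
  cube (1-x^ (suc k)) ⊗ fromSeries (factor3 (suc k) c) ≈ cube (1+x^ (suc k)) ⊗ fromSeries c
fromSeries-factor3 k c = begin
  u ⊗ u ⊗ u ⊗ fromSeries (div (div (div c₃)))   ≈⟨ peel u u _ ⟩
  u ⊗ u ⊗ (u ⊗ fromSeries (div (div (div c₃)))) ≈⟨ *-congˡ (fromSeries-div1- k (div (div c₃))) ⟩
  u ⊗ u ⊗ fromSeries (div (div c₃))             ≈⟨ ⊗-assoc′ u u _ ⟩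
  u ⊗ (u ⊗ fromSeries (div (div c₃)))           ≈⟨ *-congˡ (fromSeries-div1- k (div c₃)) ⟩
  u ⊗ fromSeries (div c₃)                       ≈⟨ fromSeries-div1- k c₃ ⟩
  fromSeries (mul (mul (mul c)))                ≈⟨ fromSeries-mul1+ (suc k) (mul (mul c)) ⟩
  v ⊗ fromSeries (mul (mul c))                  ≈⟨ *-congˡ (fromSeries-mul1+ (suc k) (mul c)) ⟩
  v ⊗ (v ⊗ fromSeries (mul c))                  ≈⟨ ⊗-assoc′ v v _ ⟨
  v ⊗ v ⊗ fromSeries (mul c)                    ≈⟨ *-congˡ (fromSeries-mul1+ (suc k) c) ⟩
  v ⊗ v ⊗ (v ⊗ fromSeries c)                    ≈⟨ peel v v _ ⟨
  v ⊗ v ⊗ v ⊗ fromSeries c                      ∎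
  where
  u = 1-x^ (suc k)
  v = 1+x^ (suc k)
  div = div1- (suc k)
  mul = mul1+ (suc k)
  c₃ = mul (mul (mul c))
  ⊗-assoc′ : ∀ f g h → f ⊗ g ⊗ h ≈ f ⊗ (g ⊗ h)
  ⊗-assoc′ f g h = pointwise (⊗-assoc f g h)
  peel : ∀ f g h → f ⊗ g ⊗ g ⊗ h ≈ f ⊗ g ⊗ (g ⊗ h)
  peel f g h = ⊗-assoc′ (f ⊗ g) g h

fromSeries-partialProd : ∀ n → cube (minusProd 0 n) ⊗ fromSeries (partialProd n) ≈ cube (plusProd n)
fromSeries-partialProd zero = trans
  (*-congˡ {cube (const 1ℤ)} {fromSeries (partialProd 0)} {const 1ℤ}
    (pointwise λ { zero → ≡.refl ; (suc m) → ≡.refl }))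
  (solve 0 (con 1ℤ :* con 1ℤ :* con 1ℤ :* con 1ℤ := con 1ℤ :* con 1ℤ :* con 1ℤ) refl)
fromSeries-partialProd (suc n) = begin
  cube (b ⊗ 1-x^ (suc n)) ⊗ fromSeries (partialProd (suc n))
    ≈⟨ solve 3 (λ b y p → b :* y :* (b :* y) :* (b :* y) :* p := b :* b :* b :* (y :* y :* y :* p)) refl
         b (1-x^ (suc n)) (fromSeries (partialProd (suc n))) ⟩
  cube b ⊗ (cube (1-x^ (suc n)) ⊗ fromSeries (partialProd (suc n)))
    ≈⟨ *-congˡ (fromSeries-factor3 n (partialProd n)) ⟩
  cube b ⊗ (cube (1+x^ (suc n)) ⊗ fromSeries (partialProd n))
    ≈⟨ solve 3 (λ b y p → b :* b :* b :* (y :* y :* y :* p) := y :* y :* y :* (b :* b :* b :* p)) refl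
         b (1+x^ (suc n)) (fromSeries (partialProd n)) ⟩
  cube (1+x^ (suc n)) ⊗ (cube b ⊗ fromSeries (partialProd n))
    ≈⟨ *-congˡ (fromSeries-partialProd n) ⟩
  cube (1+x^ (suc n)) ⊗ cube (plusProd n)
    ≈⟨ solve 2 (λ y a → y :* y :* y :* (a :* a :* a) := y :* a :* (y :* a) :* (y :* a)) refl
         (1+x^ (suc n)) (plusProd n) ⟩
  cube (1+x^ (suc n) ⊗ plusProd n) ∎
  where b = minusProd 0 n

plusProd-0 : ∀ n → plusProd n 0 ≡ 1ℤ
plusProd-0 zero    = ≡.refl
plusProd-0 (suc n) = cong (1ℤ ℤ.*_) (plusProd-0 n)

-- With y = x^{n+1}, the finite identity gives at = b + yR, and the product formula gives b³p = a³.
-- Hence a³(t³p - 1) = ((b + yR)³ - b³)p is divisible by y, and a³ has constant term 1, so it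
-- cancels.
theta³-partialProd : ∀ n → VanishesBelow (suc n)
  (cube (theta (halfTheta n)) ⊗ fromSeries (partialProd n) ⊕ ⊝ const 1ℤ)
theta³-partialProd n
  with R , eq ← partialSum-minusProd n {0} (ℕ.+-identityʳ n) =
  vanishesBelow-cancel (suc n) (cube a) cube-0 λ m m<n →
    ≡.trans (at product m) (vanishesBelow-x^ (suc n) (Q R) m m<n)
  where
  a = plusProd n
  b = minusProd 0 n
  t = theta (halfTheta n)
  p = fromSeries (partialProd n)
  y = x^ (suc n)
  -- The quotient of ((b + yR)³ - b³)p by y.
  Q : ℤ⟦x⟧ → ℤ⟦x⟧
  Q R = R ⊗ (const (+ 3) ⊗ b ⊗ b ⊕ const (+ 3) ⊗ b ⊗ (y ⊗ R) ⊕ y ⊗ R ⊗ (y ⊗ R)) ⊗ p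
  cube-0 : cube a 0 ≡ 1ℤ
  cube-0 = cong₂ ℤ._*_ (cong₂ ℤ._*_ (plusProd-0 n) (plusProd-0 n)) (plusProd-0 n)
  at≈ : a ⊗ t ≈ b ⊕ y ⊗ R
  at≈ = trans (sym (partialSum-theta n)) eq
  product : cube a ⊗ (cube t ⊗ p ⊕ ⊝ const 1ℤ) ≈ y ⊗ Q R
  product = begin
    cube a ⊗ (cube t ⊗ p ⊕ ⊝ const 1ℤ)
      ≈⟨ solve 3 (λ a t p → a :* a :* a :* (t :* t :* t :* p :+ :- con 1ℤ)
           := a :* t :* (a :* t) :* (a :* t) :* p :+ :- (a :* a :* a)) refl a t p ⟩
    cube (a ⊗ t) ⊗ p ⊕ ⊝ cube a
      ≈⟨ +-cong (*-congʳ (⊗-cong (⊗-cong at≈ at≈) at≈)) (-‿cong (sym (fromSeries-partialProd n))) ⟩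
    cube (b ⊕ y ⊗ R) ⊗ p ⊕ ⊝ (cube b ⊗ p)
      ≈⟨ solve 4 (λ b y R p →
             (b :+ y :* R) :* (b :+ y :* R) :* (b :+ y :* R) :* p :+ :- (b :* b :* b :* p)
           := y :* (R :* (con (+ 3) :* b :* b :+ con (+ 3) :* b :* (y :* R) :+ y :* R :* (y :* R)) :* p))
           refl b y R p ⟩
    y ⊗ Q R ∎

-- Supports in residue classes

Supp : (ℕ → Set) → ℤ⟦x⟧ → Set
Supp P f = ∀ i → f i ≡ 0ℤ ⊎ P i

Residue : ℕ → ℕ → ℕ → Set
Residue m r i = ∃ λ k → i ≡ k * m + r

-- The predicates vary in the induction: `tail f` is supported on `P ∘ suc`, and the remaining
-- product on `R ∘ suc`.
⊗-supp : ∀ {P Q R : ℕ → Set} → (∀ {i j} → P i → Q j → R (i + j)) →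
  ∀ {f g} → Supp P f → Supp Q g → Supp R (f ⊗ g)
⊗-supp {P} {Q} {R} pq {f} {g} sf sg zero = term (sf 0) (sg 0)
  where
  term : f 0 ≡ 0ℤ ⊎ P 0 → g 0 ≡ 0ℤ ⊎ Q 0 → f 0 ℤ.* g 0 ≡ 0ℤ ⊎ R 0
  term (inj₁ p) _        = inj₁ (≡.trans (cong (ℤ._* g 0) p) (ℤ.*-zeroˡ (g 0)))
  term (inj₂ _) (inj₁ q) = inj₁ (≡.trans (cong (f 0 ℤ.*_) q) (ℤ.*-zeroʳ (f 0)))
  term (inj₂ p) (inj₂ q) = inj₂ (pq p q)
⊗-supp {P} {Q} {R} pq {f} {g} sf sg (suc n) =
  add (term (sf 0) (sg (suc n))) (⊗-supp {P ∘ suc} {Q} {R ∘ suc} pq (sf ∘ suc) sg n)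
  where
  term : f 0 ≡ 0ℤ ⊎ P 0 → g (suc n) ≡ 0ℤ ⊎ Q (suc n) → f 0 ℤ.* g (suc n) ≡ 0ℤ ⊎ R (suc n)
  term (inj₁ p) _        = inj₁ (≡.trans (cong (ℤ._* g (suc n)) p) (ℤ.*-zeroˡ (g (suc n))))
  term (inj₂ _) (inj₁ q) = inj₁ (≡.trans (cong (f 0 ℤ.*_) q) (ℤ.*-zeroʳ (f 0)))
  term (inj₂ p) (inj₂ q) = inj₂ (pq p q)
  add : ∀ {a b} {X : Set} → a ≡ 0ℤ ⊎ X → b ≡ 0ℤ ⊎ X → a ℤ.+ b ≡ 0ℤ ⊎ X
  add (inj₂ x)  _        = inj₂ x
  add (inj₁ _)  (inj₂ x) = inj₂ x
  add (inj₁ p)  (inj₁ q) = inj₁ (cong₂ ℤ._+_ p q)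

⊕-supp : ∀ {P f g} → Supp P f → Supp P g → Supp P (f ⊕ g)
⊕-supp sf sg i with sf i | sg i
... | inj₂ p | _      = inj₂ p
... | inj₁ _ | inj₂ q = inj₂ q
... | inj₁ p | inj₁ q = inj₁ (cong₂ ℤ._+_ p q)

⊝-supp : ∀ {P f} → Supp P f → Supp P (⊝ f)
⊝-supp sf i with sf i
... | inj₁ p = inj₁ (cong ℤ.-_ p)
... | inj₂ p = inj₂ p

Residue-+ : ∀ {m r s i j} → Residue m r i → Residue m s j → Residue m (r + s) (i + j)
Residue-+ {m} {r} {s} (k , ≡.refl) (l , ≡.refl) = k + l , lemma k l m r s
  where
  lemma : ∀ k l m r s → k * m + r + (l * m + s) ≡ (k + l) * m + (r + s)
  lemma = ℕ-Solver.solve-∀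

⊗-residue : ∀ {m r s f g} → Supp (Residue m r) f → Supp (Residue m s) g →
  Supp (Residue m (r + s)) (f ⊗ g)
⊗-residue {m} {r} {s} = ⊗-supp {Residue m r} {Residue m s} {Residue m (r + s)} Residue-+

const-residue : ∀ {m} c → Supp (Residue m 0) (const c)
const-residue c zero    = inj₂ (0 , ≡.refl)
const-residue c (suc i) = inj₁ ≡.refl

sgn-residue : ∀ {m} n → Supp (Residue m 0) (sgn n)
sgn-residue zero    = const-residue 1ℤ
sgn-residue (suc n) = ⊝-supp (sgn-residue n)

x^-supp : ∀ k → Supp (_≡ k) (x^ k)
x^-supp zero    zero    = inj₂ ≡.refl
x^-supp zero    (suc i) = inj₁ ≡.refl
x^-supp (suc k) zero    = inj₁ ≡.refl
x^-supp (suc k) (suc i) with x^-supp k i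
... | inj₁ p      = inj₁ p
... | inj₂ ≡.refl = inj₂ ≡.refl

signed-monomial-residue : ∀ {m r} n k → Residue m r k → Supp (Residue m r) (sgn n ⊗ x^ k)
signed-monomial-residue n k res = ⊗-residue (sgn-residue n) monomial
  where
  monomial : Supp (Residue _ _) (x^ k)
  monomial i with x^-supp k i
  ... | inj₁ p      = inj₁ p
  ... | inj₂ ≡.refl = inj₂ res

8⇒4 : ∀ {i} → Residue 8 1 i → Residue 4 1 i
8⇒4 (k , ≡.refl) = k * 2 , cong (_+ 1) (≡.sym (ℕ.*-assoc k 2 4))

Supp-⊆ : ∀ {P Q : ℕ → Set} {f} → (∀ {i} → P i → Q i) → Supp P f → Supp Q f
Supp-⊆ P⊆Q sf i with sf i
... | inj₁ p = inj₁ p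
... | inj₂ p = inj₂ (P⊆Q p)

evenOrOdd : ∀ n → (∃ λ t → n ≡ t * 2) ⊎ (∃ λ t → n ≡ suc (t * 2))
evenOrOdd zero = inj₁ (0 , ≡.refl)
evenOrOdd (suc n) with evenOrOdd n
... | inj₁ (t , ≡.refl) = inj₂ (t , ≡.refl)
... | inj₂ (t , ≡.refl) = inj₁ (suc t , ≡.refl)

-- The consecutive odd squares (2t + 1)² and (2t + 3)² differ by 8(t + 1).
odd-square : ∀ t → Residue 8 1 (suc (t * 2) * suc (t * 2))
odd-square zero = 0 , ≡.refl
odd-square (suc t) with k , eq ← odd-square t =
  k + suc t , ≡.trans (expand t) (≡.trans (cong (_+ suc t * 8) eq) (collect k (suc t)))
  where
  expand : ∀ t → suc (suc t * 2) * suc (suc t * 2) ≡ suc (t * 2) * suc (t * 2) + suc t * 8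
  expand = ℕ-Solver.solve-∀
  collect : ∀ k u → k * 8 + 1 + u * 8 ≡ (k + u) * 8 + 1
  collect = ℕ-Solver.solve-∀

square-residue : ∀ n → Residue 8 1 (n * n) ⊎ Residue 4 0 (n * n)
square-residue n with evenOrOdd n
... | inj₁ (t , ≡.refl) = inj₂ (t * t , lemma t)
  where
  lemma : ∀ t → t * 2 * (t * 2) ≡ t * t * 4 + 0
  lemma = ℕ-Solver.solve-∀
... | inj₂ (t , ≡.refl) = inj₁ (odd-square t)

halfTheta-split : ∀ n → ∃₂ λ a d →
  halfTheta n ≈ a ⊕ d × Supp (Residue 8 1) a × Supp (Residue 4 0) d
halfTheta-split zero = const 0ℤ , const 0ℤ
  , solve 0 (con 0ℤ := con 0ℤ :+ con 0ℤ) refl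
  , (λ { zero → inj₁ ≡.refl ; (suc i) → inj₁ ≡.refl }) , const-residue 0ℤ
halfTheta-split (suc n)
  with a , d , eq , sa , sd ← halfTheta-split n | square-residue (suc n)
... | inj₁ odd  = a ⊕ t , d
  , trans (+-congʳ {t} eq) (solve 3 (λ a d t → a :+ d :+ t := a :+ t :+ d) refl a d t)
  , ⊕-supp sa (signed-monomial-residue (suc n) (suc n * suc n) odd) , sd
  where t = sgn (suc n) ⊗ x^ (suc n * suc n)
... | inj₂ even = a , d ⊕ t
  , trans (+-congʳ {t} eq) (solve 3 (λ a d t → a :+ d :+ t := a :+ (d :+ t)) refl a d t)
  , sa , ⊕-supp sd (signed-monomial-residue (suc n) (suc n * suc n) even)
  where t = sgn (suc n) ⊗ x^ (suc n * suc n)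

Residue-% : ∀ {r i} → Residue 4 r i → i % 4 ≡ r % 4
Residue-% {r} (k , ≡.refl) =
  ≡.trans (cong (_% 4) (ℕ.+-comm (k * 4) r)) ([m+kn]%n≡m%n r k 4)

-- Inversion modulo 64

polynomial : List ℤ → ℤ⟦x⟧ → ℤ⟦x⟧
polynomial []       f = const 0ℤ
polynomial (c ∷ cs) f = const c ⊕ f ⊗ polynomial cs f

polynomial-residue : ∀ {m f} cs → Supp (Residue m 0) f → Supp (Residue m 0) (polynomial cs f)
polynomial-residue []       sf = const-residue 0ℤ
polynomial-residue (c ∷ cs) sf =
  ⊕-supp (const-residue c) (⊗-residue sf (polynomial-residue cs sf))

polynomial-cong : ∀ {f g} cs → f ≈ g → polynomial cs f ≈ polynomial cs g
polynomial-cong         []       p = refl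
polynomial-cong {f} {g} (c ∷ cs) p = +-congˡ {const c} (⊗-cong p (polynomial-cong cs p))

-- The same Horner scheme in the solver's syntax, so that coefficient lists can be used inside
-- `solve`.
:polynomial : ∀ {n} → List ℤ → Polynomial n → Polynomial n
:polynomial []       p = con 0ℤ
:polynomial (c ∷ cs) p = con c :+ p :* :polynomial cs p

-- The coefficients (−2)ᵏ C(k+2,2) of (1 + 2s)⁻³; those with k ≥ 6 vanish modulo 64.
inverseCube : List ℤ
inverseCube = + 1 ∷ -[1+ 5 ] ∷ + 24 ∷ -[1+ 79 ] ∷ + 240 ∷ -[1+ 671 ] ∷ []

-- The product differs from 1 only in degrees 6, 7 and 8, with coefficients -1792 = -64 · 28, -6144
-- = -64 · 96 and -5376 = -64 · 84.
inverseCube-theta : ∀ s → cube (theta s) ⊗ polynomial inverseCube s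
  ≈ const 1ℤ ⊕ ⊝ (const (+ 64) ⊗ (cube (s ⊗ s) ⊗ polynomial (+ 28 ∷ + 96 ∷ + 84 ∷ []) s))
inverseCube-theta = solve 1 (λ s →
  let t = con 1ℤ :+ con (+ 2) :* s in
  t :* t :* t :* :polynomial inverseCube s
  := con 1ℤ :+ :- (con (+ 64) :* (s :* s :* (s :* s) :* (s :* s) :* :polynomial (+ 28 ∷ + 96 ∷ + 84 ∷ []) s)))
  refl

-- Coefficients in d of aⁱ in the expansion of inverseCube at a + d.
v₀ v₁ v₂ v₄ : List ℤ
v₀ = inverseCube
v₁ = -[1+ 5 ] ∷ + 48 ∷ -[1+ 239 ] ∷ + 960 ∷ -[1+ 3359 ] ∷ []
v₂ = + 24 ∷ -[1+ 239 ] ∷ + 1440 ∷ -[1+ 6719 ] ∷ []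
v₄ = + 240 ∷ -[1+ 3359 ] ∷ []

-- Terms aⁱdʲ with i ≠ 3, and 1/64 of the terms with i = 3, j ≥ 1.
outside inside : ℤ⟦x⟧ → ℤ⟦x⟧ → ℤ⟦x⟧
outside a d = polynomial v₀ d ⊕ a ⊗ polynomial v₁ d ⊕ a ⊗ a ⊗ polynomial v₂ d
  ⊕ a ⊗ a ⊗ a ⊗ a ⊗ polynomial v₄ d ⊕ a ⊗ a ⊗ a ⊗ a ⊗ a ⊗ const -[1+ 671 ]
inside a d = a ⊗ a ⊗ a ⊗ (const (+ 15) ⊗ d ⊕ const -[1+ 104 ] ⊗ (d ⊗ d))

-- The constants in `inside` come from 4 · 240 = 64 · 15 and -10 · 672 = -64 · 105.
inverseCube-⊕ : ∀ a d → polynomial inverseCube (a ⊕ d)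
  ≈ outside a d ⊕ const -[1+ 79 ] ⊗ (a ⊗ a ⊗ a) ⊕ const (+ 64) ⊗ inside a d
inverseCube-⊕ = solve 2 (λ a d →
  :polynomial inverseCube (a :+ d)
  := (:polynomial v₀ d :+ a :* :polynomial v₁ d :+ a :* a :* :polynomial v₂ d
       :+ a :* a :* a :* a :* :polynomial v₄ d :+ a :* a :* a :* a :* a :* con -[1+ 671 ])
     :+ con -[1+ 79 ] :* (a :* a :* a)
     :+ con (+ 64) :* (a :* a :* a :* (con (+ 15) :* d :+ con -[1+ 104 ] :* (d :* d)))) refl

-- The coefficient of x^{8n+7}

module _ (n : ℕ) {a d : ℤ⟦x⟧} (sa : Supp (Residue 8 1) a) (sd : Supp (Residue 4 0) d) where

  private
    N = 8 * n + 7

    N%4 : N % 4 ≡ 3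
    N%4 = Residue-% {3} (suc (n * 2) , lemma n)
      where
      lemma : ∀ n → 8 * n + 7 ≡ suc (n * 2) * 4 + 3
      lemma = ℕ-Solver.solve-∀

    N%8 : ∀ {k} → N ≢ k * 8 + 3
    N%8 {k} eq = contradiction
      (≡.trans (≡.sym (reduce n 7)) (≡.trans (cong (_% 8) (≡.trans (cong (_+ 7) (ℕ.*-comm n 8)) eq)) (reduce k 3)))
      λ ()
      where
      reduce : ∀ k r → (k * 8 + r) % 8 ≡ r % 8
      reduce k r = ≡.trans (cong (_% 8) (ℕ.+-comm (k * 8) r)) ([m+kn]%n≡m%n r k 8)

    vanish : ∀ r {f} → r % 4 ≢ 3 → Supp (Residue 4 r) f → f N ≡ 0ℤ
    vanish r r≢3 sf with sf N
    ... | inj₁ p = p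
    ... | inj₂ p = contradiction (≡.trans (≡.sym (Residue-% {r} p)) N%4) r≢3

    sa₄ : Supp (Residue 4 1) a
    sa₄ = Supp-⊆ 8⇒4 sa

    sa² : Supp (Residue 4 2) (a ⊗ a)
    sa² = ⊗-residue sa₄ sa₄

    sa⁴ : Supp (Residue 4 4) (a ⊗ a ⊗ a ⊗ a)
    sa⁴ = ⊗-residue (⊗-residue sa² sa₄) sa₄

    sp : ∀ cs → Supp (Residue 4 0) (polynomial cs d)
    sp cs = polynomial-residue cs sd

  -- Factors in d have residue 0 modulo 4, so the block of aⁱ has residue i. For i = 0, 1, 2, 4, 5
  -- this is never 3 modulo 4, while N is; the offsets 4 and 5 are reduced only inside `vanish`.
  outside-vanishes : outside a d N ≡ 0ℤ
  outside-vanishes = cong₂ ℤ._+_ (cong₂ ℤ._+_ (cong₂ ℤ._+_ (cong₂ ℤ._+_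
    (vanish 0 (λ ()) (sp v₀))
    (vanish 1 (λ ()) (⊗-residue sa₄ (sp v₁))))
    (vanish 2 (λ ()) (⊗-residue sa² (sp v₂))))
    (vanish 4 (λ ()) (⊗-residue sa⁴ (sp v₄))))
    (vanish 5 (λ ()) (⊗-residue (⊗-residue sa⁴ sa₄) (const-residue -[1+ 671 ])))

  -- Modulo 4 the exponents of a³ agree with N, so the finer class of a is used: they are 3 modulo
  -- 8, and N is 7.
  cube-vanishes : (a ⊗ a ⊗ a) N ≡ 0ℤ
  cube-vanishes with ⊗-residue (⊗-residue sa sa) sa N
  ... | inj₁ p        = p
  ... | inj₂ (k , eq) = contradiction eq (N%8 {k})

theorem2p9 : (n : ℕ) → 64 ∣ pbar3 (8 * n + 7)
theorem2p9 n with a , d , split , sa , sd ← halfTheta-split (8 * n + 7) =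
  ∣⇒∣ᵤ (divides (inside a d N ℤ.+ (k ⊗ p) N) (≡.trans (at expansion N) coefficient))
  where
  N = 8 * n + 7
  s = halfTheta N
  p = fromSeries (partialProd N)
  w = polynomial inverseCube s
  -- The error in theta(s)³ p = 1, which vanishes up to and including x^N; multiplying by w
  -- preserves this.
  h = cube (theta s) ⊗ p ⊕ ⊝ const 1ℤ
  k = cube (s ⊗ s) ⊗ polynomial (+ 28 ∷ + 96 ∷ + 84 ∷ []) s
  e = outside a d ⊕ const -[1+ 79 ] ⊗ (a ⊗ a ⊗ a) ⊕ const (+ 64) ⊗ inside a d
  w≈e : w ≈ e
  w≈e = trans (polynomial-cong inverseCube split) (inverseCube-⊕ a d)
  expansion : p ≈ e ⊕ w ⊗ h ⊕ const (+ 64) ⊗ (k ⊗ p)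
  expansion = begin
    p
      -- Since theta(s)³ w = 1 - 64k, writing p = (1 - 64k)p + 64kp yields p = w + w(theta(s)³ p -
      -- 1) + 64kp.
      ≈⟨ solve 2 (λ p k → p := (con 1ℤ :+ :- k) :* p :+ k :* p) refl p (const (+ 64) ⊗ k) ⟩
    (const 1ℤ ⊕ ⊝ (const (+ 64) ⊗ k)) ⊗ p ⊕ const (+ 64) ⊗ k ⊗ p
      ≈⟨ +-congʳ {const (+ 64) ⊗ k ⊗ p} (*-congʳ {p} (inverseCube-theta s)) ⟨
    cube (theta s) ⊗ w ⊗ p ⊕ const (+ 64) ⊗ k ⊗ p
      ≈⟨ solve 5 (λ t w p c k → t :* w :* p :+ c :* k :* p
           := w :+ w :* (t :* p :+ :- con 1ℤ) :+ c :* (k :* p)) refl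
           (cube (theta s)) w p (const (+ 64)) k ⟩
    w ⊕ w ⊗ h ⊕ const (+ 64) ⊗ (k ⊗ p)
      ≈⟨ +-congʳ {const (+ 64) ⊗ (k ⊗ p)} (+-congʳ {w ⊗ h} w≈e) ⟩
    e ⊕ w ⊗ h ⊕ const (+ 64) ⊗ (k ⊗ p) ∎
  coefficient : (e ⊕ w ⊗ h ⊕ const (+ 64) ⊗ (k ⊗ p)) N ≡ (inside a d N ℤ.+ (k ⊗ p) N) ℤ.* + 64
  -- At N only `inside` and k ⊗ p survive, both with the factor 64.
  coefficient = ≡.trans
    (cong₂ ℤ._+_ (cong₂ ℤ._+_ (cong₂ ℤ._+_ (cong₂ ℤ._+_
      (outside-vanishes n sa sd)
      (≡.trans (const-⊗ -[1+ 79 ] (a ⊗ a ⊗ a) N) (cong (ℤ._*_ -[1+ 79 ]) (cube-vanishes n sa sd))))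
      (const-⊗ (+ 64) (inside a d) N))
      (vanishesBelow-⊗ (suc N) w (theta³-partialProd N) N ℕ.≤-refl))
      (const-⊗ (+ 64) (k ⊗ p) N))
    (collect (inside a d N) ((k ⊗ p) N))
    where
    collect : ∀ u v → 0ℤ ℤ.+ 0ℤ ℤ.+ + 64 ℤ.* u ℤ.+ 0ℤ ℤ.+ + 64 ℤ.* v ≡ (u ℤ.+ v) ℤ.* + 64
    collect = ℤ-Solver.solve-∀
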